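{- There are no positive integers $a$ and $b$ such that $\binom{an+bn}{an}\equiv 0\pmod{3n-1}$ for all integers $n\ge 1$. -}

module Defs where

{-# OPTIONS --safe #-}
module Submission where

-- Fix a prime p ≠ 3 not dividing a + b and choose t with p ^ t = 1 + w (a + b).
-- For n = u w with 1 ≤ u < p and 3 n ≡ 1 (mod p) we get (a + b) n = u p ^ t − u,
-- whose base-p digits are u − 1, p − 1, …, p − 1, p − u.  By Lucas' theorem p does
-- not divide the binomial coefficient as soon as the lowest digit of a n is at most
-- that of (a + b) n, while p divides 3 n − 1.  A suitable p exists in every case:
--   * 3 ∤ a + b: take p ∣ a + b + 3, so that (a + b) n ≡ −1;
--   * 3 ∣ a and 3 ∣ b: take p > a + b, so that the digits are a / 3 and (a + b) / 3;
--   * otherwise a ≠ b are prime to 3: take p with different exponents in a and b;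
--     by Lucas a common power of p may be removed, and then p divides exactly one.

open import Defs
open import Data.Nat using (ℕ; zero; suc; _+_; _*_; _∸_; _^_; _≤_; _<_; _≥_; z≤n; s≤s; NonZero; ≢-nonZero; ≢-nonZero⁻¹; >-nonZero; >-nonZero⁻¹; nonTrivial⇒n>1; _!)
open import Data.Nat.Properties
open import Data.Nat.Divisibility
open import Data.Nat.DivMod
open import Data.Nat.GCD using (gcd; gcd[m,n]∣m; gcd[m,n]∣n; gcd[m,n]≢0)
open import Data.Nat.Coprimality as Coprimality using (Coprime; coprime-divisor; coprime-/gcd)
open import Data.Nat.Combinatorics using (_C_; nCk+nC[k+1]≡[n+1]C[k+1]; nCk≡n!/k![n-k]!; k![n∸k]!∣n!; nCn≡1; k>n⇒nCk≡0; nCk≡nC[n∸k])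
open import Data.Nat.Induction using (<-rec)
open import Data.Nat.Primality using (Prime; euclidsLemma; prime⇒nonTrivial; prime⇒irreducible; ¬prime[0]; ¬prime[1])
open import Data.Nat.Primality.Factorisation using (factorise)
open import Data.Nat.Tactic.RingSolver using (solve-∀)
open import Data.Fin using (toℕ)
open import Data.Fin.Properties using (pigeonhole; toℕ-fromℕ<)
open import Data.List using ([]; _∷_)
open import Data.List.Relation.Unary.All using (_∷_)
open import Data.Product using (∃; ∃₂; _×_; _,_)
open import Data.Sum using (inj₁; inj₂; [_,_]′)
open import Function using (_∘_)
open import Relation.Nullary using (¬_; Dec; yes; no; contradiction)
open import Relation.Binary.PropositionalEquality

-- Residues, and powers congruent to 1 modulo `m`.

module _ {m : ℕ} .{{_ : NonZero m}} where

  %-+-cong : ∀ x x′ y y′ → x % m ≡ x′ % m → y % m ≡ y′ % m → (x + y) % m ≡ (x′ + y′) % m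
  %-+-cong x x′ y y′ p q = begin
    (x + y) % m            ≡⟨ %-distribˡ-+ x y m ⟩
    (x % m + y % m) % m    ≡⟨ cong₂ (λ i j → (i + j) % m) p q ⟩
    (x′ % m + y′ % m) % m  ≡⟨ %-distribˡ-+ x′ y′ m ⟨
    (x′ + y′) % m          ∎
    where open ≡-Reasoning

  %≡⇒∣∸ : ∀ x y → x % m ≡ y % m → m ∣ y ∸ x
  %≡⇒∣∸ x y eq = divides (y / m ∸ x / m) (begin
    y ∸ x                                          ≡⟨ cong₂ _∸_ (m≡m%n+[m/n]*n y m) (m≡m%n+[m/n]*n x m) ⟩
    (y % m + y / m * m) ∸ (x % m + x / m * m)      ≡⟨ cong (λ r → (y % m + y / m * m) ∸ (r + x / m * m)) eq ⟩
    (y % m + y / m * m) ∸ (y % m + x / m * m)      ≡⟨ [m+n]∸[m+o]≡n∸o (y % m) (y / m * m) (x / m * m) ⟩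
    y / m * m ∸ x / m * m                          ≡⟨ *-distribʳ-∸ m (y / m) (x / m) ⟨
    (y / m ∸ x / m) * m                            ∎)
    where open ≡-Reasoning

  digit : ∀ {r} k → r < m → (r + k * m) % m ≡ r
  digit {r} k r<m = trans ([m+kn]%n≡m%n r k m) (m<n⇒m%n≡m r<m)

coprime-cancel-^ : ∀ {m b} i {x} → Coprime m b → m ∣ b ^ i * x → m ∣ x
coprime-cancel-^ zero {x} c d = subst (_ ∣_) (*-identityˡ x) d
coprime-cancel-^ {m} {b} (suc i) {x} c d =
  coprime-cancel-^ i c (coprime-divisor c (subst (m ∣_) (*-assoc b (b ^ i) x) d))

-- Among `b ^ 0`, ..., `b ^ m` two powers agree modulo `m`, and the smaller one can be cancelled.
-- The exponent is a successor so that callers can split off one factor `b`.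
coprime⇒^≡1 : ∀ b m .{{_ : NonZero b}} .{{_ : NonZero m}} → Coprime m b → ∃₂ λ t w → b ^ suc t ≡ 1 + w * m
coprime⇒^≡1 b m c with pigeonhole (n<1+n m) (λ i → (b ^ toℕ i) mod m)
... | i , j , i<j , eq with m≤n⇒∃[o]m+o≡n i<j
... | t , si+t≡j with
      coprime-cancel-^ (toℕ i) c (subst (m ∣_) difference (%≡⇒∣∸ (b ^ toℕ i) (b ^ toℕ j) residues))
  where
  residues : b ^ toℕ i % m ≡ b ^ toℕ j % m
  residues = trans (sym (toℕ-fromℕ< (m%n<n (b ^ toℕ i) m))) (trans (cong toℕ eq) (toℕ-fromℕ< (m%n<n (b ^ toℕ j) m)))
  difference : b ^ toℕ j ∸ b ^ toℕ i ≡ b ^ toℕ i * (b ^ suc t ∸ 1)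
  difference = begin
    b ^ toℕ j ∸ b ^ toℕ i                    ≡⟨ cong (λ k → b ^ k ∸ b ^ toℕ i) (trans (sym si+t≡j) (sym (+-suc (toℕ i) t))) ⟩
    b ^ (toℕ i + suc t) ∸ b ^ toℕ i          ≡⟨ cong₂ _∸_ (^-distribˡ-+-* b (toℕ i) (suc t)) (sym (*-identityʳ (b ^ toℕ i))) ⟩
    b ^ toℕ i * b ^ suc t ∸ b ^ toℕ i * 1    ≡⟨ *-distribˡ-∸ (b ^ toℕ i) (b ^ suc t) 1 ⟨
    b ^ toℕ i * (b ^ suc t ∸ 1)              ∎
    where open ≡-Reasoning
... | divides w eq′ = t , w , trans (sym (m+[n∸m]≡n (m^n>0 b (suc t)))) (cong suc eq′)

-- Existence and divisibility of primes.

∃-primeDivisor : ∀ n → 1 < n → ∃ λ q → Prime (suc q) × suc q ∣ n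
∃-primeDivisor (suc n) 1<n with factorise (suc n)
... | record { factors = [] ; isFactorisation = eq } = contradiction (sym eq) (<⇒≢ 1<n)
... | record { factors = zero ∷ _ ; factorsPrime = pr ∷ _ } = contradiction pr ¬prime[0]
... | record { factors = suc q ∷ _ ; isFactorisation = eq ; factorsPrime = pr ∷ _ } =
  q , pr , subst (suc q ∣_) (sym eq) (m∣m*n _)

-- Euclid's argument: a prime factor of `n ! + 1` cannot be at most `n`.
∃-prime> : ∀ n → ∃ λ q → Prime (suc q) × n < suc q
∃-prime> n with ∃-primeDivisor (suc (n !)) (s≤s (>-nonZero⁻¹ (n !) {{n !≢0}}))
... | q , pr , p∣n!+1 = q , pr , ≰⇒> λ p≤n →
  ¬prime[1] (subst Prime (∣1⇒≡1 (∣m+n∣m⇒∣n (subst (suc q ∣_) (+-comm 1 (n !)) p∣n!+1)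
    (∣-trans (m∣m*n _) (m≤n⇒m!∣n! p≤n)))) pr)

prime∤⇒coprime : ∀ {p m} → Prime p → p ∤ m → Coprime p m
prime∤⇒coprime pr p∤m (d∣p , d∣m) with prime⇒irreducible pr d∣p
... | inj₁ d≡1 = d≡1
... | inj₂ refl = contradiction d∣m p∤m

prime∤1 : ∀ {p} → Prime p → p ∤ 1
prime∤1 pr p∣1 = ¬prime[1] (subst Prime (∣1⇒≡1 p∣1) pr)

prime∣3⇒≡3 : ∀ {p} → Prime p → p ∣ 3 → p ≡ 3
prime∣3⇒≡3 {0} pr _ = contradiction pr ¬prime[0]
prime∣3⇒≡3 {1} pr _ = contradiction pr ¬prime[1]
prime∣3⇒≡3 {2} pr 2∣3 = contradiction (n∣m⇒m%n≡0 3 2 2∣3) λ ()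
prime∣3⇒≡3 {3} pr _ = refl
prime∣3⇒≡3 {suc (suc (suc (suc _)))} pr p∣3 = contradiction p∣3 (>⇒∤ (s≤s (s≤s (s≤s (s≤s z≤n)))))

-- Binomial coefficients modulo a prime.

nCk*k![n∸k]!≡n! : ∀ {n k} → k ≤ n → (n C k) * (k ! * (n ∸ k) !) ≡ n !
nCk*k![n∸k]!≡n! {n} {k} k≤n = trans
  (cong (_* (k ! * (n ∸ k) !)) (nCk≡n!/k![n-k]! k≤n))
  (m/n*n≡m {{k !* (n ∸ k) !≢0}} (k![n∸k]!∣n! k≤n))

+C-comm : ∀ x y → (x + y) C x ≡ (y + x) C y
+C-comm x y = begin
  (x + y) C x            ≡⟨ nCk≡nC[n∸k] (m≤m+n x y) ⟩
  (x + y) C (x + y ∸ x)  ≡⟨ cong₂ _C_ (+-comm x y) (m+n∸m≡n x y) ⟩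
  (y + x) C y            ∎
  where open ≡-Reasoning

module _ {q : ℕ} (pr : Prime (suc q)) where

  private
    p : ℕ
    p = suc q

  prime∤! : ∀ {n} → n < p → p ∤ n !
  prime∤! {zero}  _   = prime∤1 pr
  prime∤! {suc n} n<p = [ >⇒∤ n<p , prime∤! (<-trans (n<1+n n) n<p) ]′ ∘ euclidsLemma (suc n) (n !) pr

  prime∤C : ∀ {n k} → k ≤ n → n < p → p ∤ n C k
  prime∤C {n} {k} k≤n n<p p∣C = prime∤! n<p (subst (p ∣_) (nCk*k![n∸k]!≡n! k≤n) (∣m⇒∣m*n _ p∣C))

  -- The prime divides `p !` but neither of the two factorials in the denominator, as both arguments
  -- are below `p`.
  prime∣pCk : ∀ {k} → suc k < p → p ∣ p C suc k
  prime∣pCk {k} k<p with euclidsLemma (p C suc k) _ pr (subst (p ∣_) (sym (nCk*k![n∸k]!≡n! (<⇒≤ k<p))) (m∣m*n (q !)))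
  ... | inj₁ p∣C = p∣C
  ... | inj₂ p∣k![p∸k]! with euclidsLemma (suc k !) _ pr p∣k![p∸k]!
  ...   | inj₁ p∣k! = contradiction p∣k! (prime∤! k<p)
  ...   | inj₂ p∣[p∸k]! = contradiction p∣[p∸k]! (prime∤! (s≤s (m∸n≤m q k)))

  pascal-≡ : ∀ n k x y → (n C k) % p ≡ x % p → (n C suc k) % p ≡ y % p → (suc n C suc k) % p ≡ (x + y) % p
  pascal-≡ n k x y eq₁ eq₂ = trans (cong (_% p) (sym (nCk+nC[k+1]≡[n+1]C[k+1] n k))) (%-+-cong (n C k) x (n C suc k) y eq₁ eq₂)

  -- Pascal's rule lowers the upper number by one. A lowest digit 0 borrows from the higher part and
  -- becomes `q`, so the recursion is lexicographic in `A` and `r`.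
  lucas : ∀ A B r s → r < p → s < p → ((r + A * p) C (s + B * p)) % p ≡ ((A C B) * (r C s)) % p
  lucas zero zero zero zero _ _ = refl
  lucas zero (suc B) zero zero _ _ = refl
  lucas zero B zero (suc s) _ _ = cong (_% p) (sym (*-zeroʳ (0 C B)))
  lucas A zero (suc r) zero _ _ = refl
  lucas (suc A) zero zero zero _ _ = refl
  lucas A B (suc r) (suc s) r<p s<p = trans
    (pascal-≡ (r + A * p) (s + B * p) ((A C B) * (r C s)) ((A C B) * (r C suc s))
      (lucas A B r s (<-trans (n<1+n r) r<p) (<-trans (n<1+n s) s<p))
      (lucas A B r (suc s) (<-trans (n<1+n r) r<p) s<p))
    (cong (_% p) (trans (sym (*-distribˡ-+ (A C B) (r C s) (r C suc s)))
      (cong ((A C B) *_) (nCk+nC[k+1]≡[n+1]C[k+1] r s))))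
  lucas A (suc B) (suc r) zero r<p@(s≤s r<q) s<p = trans
    (pascal-≡ (r + A * p) (q + B * p) ((A C B) * (r C q)) ((A C suc B) * 1)
      (lucas A B r q (<-trans (n<1+n r) r<p) (n<1+n q))
      (lucas A (suc B) r zero (<-trans (n<1+n r) r<p) s<p))
    -- Only the lower number borrows: its new digit `q` exceeds `r`, so this Pascal term vanishes.
    (cong (λ c → (c + (A C suc B) * 1) % p) (trans (cong ((A C B) *_) (k>n⇒nCk≡0 r<q)) (*-zeroʳ (A C B))))
  lucas (suc A) B zero (suc s) r<p s<p = trans
    (pascal-≡ (q + A * p) (s + B * p) ((A C B) * (q C s)) ((A C B) * (q C suc s))
      (lucas A B q s (n<1+n q) (<-trans (n<1+n s) s<p))
      (lucas A B q (suc s) (n<1+n q) s<p))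
    (begin
      ((A C B) * (q C s) + (A C B) * (q C suc s)) % p  ≡⟨ cong (_% p) (*-distribˡ-+ (A C B) (q C s) (q C suc s)) ⟨
      ((A C B) * (q C s + q C suc s)) % p              ≡⟨ cong (λ c → ((A C B) * c) % p) (nCk+nC[k+1]≡[n+1]C[k+1] q s) ⟩
      -- Only the upper number borrows: the two terms recombine to `p C suc s`, which vanishes
      -- modulo `p` just as `0 C suc s` does.
      ((A C B) * (p C suc s)) % p                      ≡⟨ n∣m⇒m%n≡0 _ p (∣n⇒∣m*n (A C B) (prime∣pCk s<p)) ⟩
      0                                                ≡⟨ cong (_% p) (*-zeroʳ (suc A C B)) ⟨
      ((suc A C B) * 0) % p                            ∎)
    where open ≡-Reasoning
  lucas (suc A) (suc B) zero zero r<p s<p = trans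
    (pascal-≡ (q + A * p) (q + B * p) ((A C B) * (q C q)) ((A C suc B) * 1)
      (lucas A B q q (n<1+n q) (n<1+n q))
      (lucas A (suc B) q zero (n<1+n q) s<p))
    (cong (_% p) (begin
      (A C B) * (q C q) + (A C suc B) * 1  ≡⟨ cong (λ c → (A C B) * c + (A C suc B) * 1) (nCn≡1 q) ⟩
      (A C B) * 1 + (A C suc B) * 1        ≡⟨ *-distribʳ-+ 1 (A C B) (A C suc B) ⟨
      (A C B + A C suc B) * 1              ≡⟨ cong (_* 1) (nCk+nC[k+1]≡[n+1]C[k+1] A B) ⟩
      (suc A C suc B) * 1                  ∎))
    where open ≡-Reasoning

  lucas-∤ : ∀ A B {r s} → s ≤ r → r < p → p ∤ A C B → p ∤ (r + A * p) C (s + B * p)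
  lucas-∤ A B {r} {s} s≤r r<p p∤ACB p∣C =
    [ p∤ACB , prime∤C s≤r r<p ]′ (euclidsLemma (A C B) (r C s) pr
      (m%n≡0⇒n∣m _ p (trans (sym (lucas A B r s r<p (≤-<-trans s≤r r<p))) (n∣m⇒m%n≡0 _ p p∣C))))

  -- In base `p` the number `N` has leading digit `u` followed by `t` digits `q`, so every `B ≤ N`
  -- lies below it digit by digit. The induction strips the lowest digit and leaves `N′` with
  -- `suc N′ ≡ suc u * p ^ t`.
  prime∤[up^t∸1]C : ∀ t {u N B} → u < p → suc N ≡ suc u * p ^ t → B ≤ N → p ∤ N C B
  prime∤[up^t∸1]C zero {u} u<p eq B≤N with suc-injective (trans eq (*-identityʳ (suc u)))
  ... | refl = prime∤C B≤N u<p
  prime∤[up^t∸1]C (suc t) {u} {N} {B} u<p eq B≤N with suc u * p ^ t in N′-eq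
  ... | zero = contradiction N′-eq (≢-nonZero⁻¹ _ {{m*n≢0 (suc u) (p ^ t) {{_}} {{m^n≢0 p t}}}})
  ... | suc N′ = subst₂ (λ n b → p ∤ n C b) (sym N≡) (sym (m≡m%n+[m/n]*n B p))
      (lucas-∤ N′ (B / p) (≤-pred (m%n<n B p)) (n<1+n q)
        (prime∤[up^t∸1]C t u<p (sym N′-eq) (≤-pred (m<n*o⇒m/o<n (subst (B <_) (cong suc N≡) (s≤s B≤N))))))
    where
    open ≡-Reasoning
    N≡ : N ≡ q + N′ * p
    N≡ = suc-injective (begin
      suc N                 ≡⟨ eq ⟩
      suc u * (p * p ^ t)   ≡⟨ cong (suc u *_) (*-comm p (p ^ t)) ⟩
      suc u * (p ^ t * p)   ≡⟨ *-assoc (suc u) (p ^ t) p ⟨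
      suc u * p ^ t * p     ≡⟨ cong (_* p) N′-eq ⟩
      suc N′ * p            ∎)

  -- Inverses modulo `p` and the construction of `n`.

  ∃-inverse : ∀ {x} → p ∤ x → ∃₂ λ u v → suc u < p × suc u * x ≡ 1 + v * p
  ∃-inverse {zero} p∤x = contradiction (p ∣0) p∤x
  ∃-inverse {x@(suc _)} p∤x with coprime⇒^≡1 x p (prime∤⇒coprime pr p∤x)
  -- Since `x ^ suc t` is 1 modulo `p`, the residue of `x ^ t` is an inverse of `x`.
  ... | t , w , eq with x ^ t % p in u-eq | m%n<n (x ^ t) p
  ...   | u | u<p = nonzero u (u * x / p) u<p ux≡1
    where
    open ≡-Reasoning
    [ux]%p≡1 : (u * x) % p ≡ 1
    [ux]%p≡1 = begin
      (u * x) % p                    ≡⟨ %-distribˡ-* u x p ⟩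
      ((u % p) * (x % p)) % p        ≡⟨ cong (λ c → (c * (x % p)) % p) (trans (m<n⇒m%n≡m u<p) (sym u-eq)) ⟩
      ((x ^ t % p) * (x % p)) % p    ≡⟨ %-distribˡ-* (x ^ t) x p ⟨
      (x ^ t * x) % p                ≡⟨ cong (_% p) (trans (*-comm (x ^ t) x) eq) ⟩
      (1 + w * p) % p                ≡⟨ digit w (nonTrivial⇒n>1 p {{prime⇒nonTrivial pr}}) ⟩
      1                              ∎
    ux≡1 : u * x ≡ 1 + (u * x / p) * p
    ux≡1 = trans (m≡m%n+[m/n]*n (u * x) p) (cong (_+ (u * x / p) * p) [ux]%p≡1)
    nonzero : ∀ u v → u < p → u * x ≡ 1 + v * p → ∃₂ λ u v → suc u < p × suc u * x ≡ 1 + v * p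
    nonzero (suc u) v u<p eq = u , v , u<p , eq

  -- The prime `p` certifies that `3 * n ∸ 1` does not divide the coefficient. It stays fixed
  -- because `nonDivisor-*p` carries a witness over to `a * p` and `b * p` for the same prime.
  NonDivisor : ℕ → ℕ → Set
  NonDivisor a b = ∃ λ n → n ≥ 1 × p ∣ 3 * n ∸ 1 × p ∤ (a * n + b * n) C (a * n)

  -- The last hypothesis ranges over all `n` inverse to 3 modulo `p`, since `n` is only built
  -- inside; the two lowest digits depend on `n` only through this residue.
  noCarry⇒nonDivisor : ∀ a b → p ∤ 3 → p ∤ a + b →
    (∀ n v → 3 * n ≡ 1 + v * p → (a * n) % p ≤ ((a + b) * n) % p) → NonDivisor a b
  noCarry⇒nonDivisor a b p∤3 p∤M noCarry with coprime⇒^≡1 p (a + b) {{_}} {{M≢0}} (Coprimality.sym (prime∤⇒coprime pr p∤M))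
    where
    M≢0 : NonZero (a + b)
    M≢0 = ≢-nonZero λ eq → p∤M (subst (p ∣_) (sym eq) (p ∣0))
  -- `w * (a + b)` is -1 modulo `p`, so `p ∤ w` and `3 * w` is invertible. Its inverse `suc u` is
  -- the multiplier that gives `3 * n` the residue 1.
  ... | t , w , p^t≡ with ∃-inverse {3 * w} ([ p∤3 , p∤w ]′ ∘ euclidsLemma 3 w pr)
    where
    p∤w : p ∤ w
    p∤w p∣w = prime∤1 pr (∣m+n∣m⇒∣n (subst (p ∣_) (trans p^t≡ (+-comm 1 _)) (m∣m*n (p ^ t))) (∣m⇒∣m*n (a + b) p∣w))
  ... | u , v , u<p , inv with suc u * p ^ t in N′-eq
  ...   | zero = contradiction N′-eq (≢-nonZero⁻¹ _ {{m*n≢0 (suc u) (p ^ t) {{_}} {{m^n≢0 p t}}}})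
  -- Here `N + suc u ≡ suc N′ * p`. Subtracting `suc u` borrows once, leaving `N′` above the lowest
  -- digit `d`, which is `p` minus `suc u`.
  ...   | suc N′ = n , n≥1 (suc u * w) 3n≡ , divides v (cong (_∸ 1) 3n≡) ,
      subst₂ (λ N k → p ∤ N C k) (sym N≡) (sym (m≡m%n+[m/n]*n (a * n) p))
        (lucas-∤ N′ (a * n / p) an%p≤d (s≤s (m∸n≤m q u))
          (prime∤[up^t∸1]C t (<-trans (n<1+n u) u<p) (sym N′-eq) (≤-pred (m<n*o⇒m/o<n an<))))
    where
    open ≡-Reasoning
    n d N : ℕ
    n = suc u * w
    d = q ∸ u
    N = a * n + b * n
    assoc-comm : ∀ u w → 3 * (u * w) ≡ u * (3 * w)
    assoc-comm = solve-∀
    3n≡ : 3 * n ≡ 1 + v * p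
    3n≡ = trans (assoc-comm (suc u) w) inv
    n≥1 : ∀ n → 3 * n ≡ 1 + v * p → n ≥ 1
    n≥1 (suc _) _ = s≤s z≤n
    expand : ∀ a b u w → (a * (u * w) + b * (u * w)) + u ≡ u * (1 + w * (a + b))
    expand = solve-∀
    N+u≡ : N + suc u ≡ suc N′ * p
    N+u≡ = begin
      N + suc u                    ≡⟨ expand a b (suc u) w ⟩
      suc u * (1 + w * (a + b))    ≡⟨ cong (suc u *_) p^t≡ ⟨
      suc u * (p * p ^ t)          ≡⟨ cong (suc u *_) (*-comm p (p ^ t)) ⟩
      suc u * (p ^ t * p)          ≡⟨ *-assoc (suc u) (p ^ t) p ⟨
      suc u * p ^ t * p            ≡⟨ cong (_* p) N′-eq ⟩
      suc N′ * p                   ∎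
    N≡ : N ≡ d + N′ * p
    N≡ = +-cancelʳ-≡ (suc u) N (d + N′ * p) (begin
      N + suc u                    ≡⟨ N+u≡ ⟩
      p + N′ * p                   ≡⟨ cong (_+ N′ * p) (m∸n+n≡m (<⇒≤ u<p)) ⟨
      d + suc u + N′ * p           ≡⟨ +-assoc d (suc u) _ ⟩
      d + (suc u + N′ * p)         ≡⟨ cong (d +_) (+-comm (suc u) _) ⟩
      d + (N′ * p + suc u)         ≡⟨ +-assoc d _ (suc u) ⟨
      d + N′ * p + suc u           ∎)
    an< : a * n < suc N′ * p
    an< = ≤-<-trans (m≤m+n (a * n) (b * n)) (subst (N <_) N+u≡ (m<m+n N (s≤s z≤n)))
    an%p≤d : (a * n) % p ≤ d
    an%p≤d = subst ((a * n) % p ≤_)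
      (trans (cong (_% p) (trans (*-distribʳ-+ n a b) N≡)) (digit N′ (s≤s (m∸n≤m q u))))
      (noCarry n v 3n≡)

  -- Conditions on `p` under which the lowest digits compare as required.

  ∣a⇒nonDivisor : ∀ a b → p ∤ 3 → p ∣ a → p ∤ b → NonDivisor a b
  ∣a⇒nonDivisor a b p∤3 p∣a p∤b = noCarry⇒nonDivisor a b p∤3 (λ p∣M → p∤b (∣m+n∣m⇒∣n p∣M p∣a))
    λ n _ _ → subst (_≤ ((a + b) * n) % p) (sym (n∣m⇒m%n≡0 (a * n) p (∣m⇒∣m*n n p∣a))) z≤n

  -- Adding `3 * n`, which is 1 modulo `p`, turns `(a + b) * n` into a multiple of `a + b + 3`.
  -- Hence the lowest digit of `(a + b) * n` is `q`, the largest possible.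
  ∣a+b+3⇒nonDivisor : ∀ a b → p ∤ 3 → p ∣ a + b + 3 → NonDivisor a b
  ∣a+b+3⇒nonDivisor a b p∤3 p∣M+3 = noCarry⇒nonDivisor a b p∤3 (p∤3 ∘ ∣m+n∣m⇒∣n p∣M+3)
    λ n v 3n≡ → subst ((a * n) % p ≤_) (sym (%-pred-≡0 {(a + b) * n} {p} (last n v 3n≡))) (≤-pred (m%n<n (a * n) p))
    where
    rearrange : ∀ M n → M * n + 3 * n ≡ (M + 3) * n
    rearrange = solve-∀
    last : ∀ n v → 3 * n ≡ 1 + v * p → suc ((a + b) * n) % p ≡ 0
    last n v 3n≡ = begin
      suc ((a + b) * n) % p                  ≡⟨ [m+kn]%n≡m%n (suc ((a + b) * n)) v p ⟨
      (suc ((a + b) * n) + v * p) % p        ≡⟨ cong (_% p) (+-suc ((a + b) * n) (v * p)) ⟨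
      ((a + b) * n + (1 + v * p)) % p        ≡⟨ cong (λ c → ((a + b) * n + c) % p) 3n≡ ⟨
      ((a + b) * n + 3 * n) % p              ≡⟨ cong (_% p) (rearrange (a + b) n) ⟩
      ((a + b + 3) * n) % p                  ≡⟨ n∣m⇒m%n≡0 _ p (∣m⇒∣m*n n p∣M+3) ⟩
      0                                      ∎
      where open ≡-Reasoning

  -- As `3 * n` is 1 modulo `p`, the lowest digits are `c` and `c + d` themselves, both being below
  -- `p`.
  3∣a,b⇒nonDivisor : ∀ c d → p ∤ 3 → 1 ≤ c → c * 3 + d * 3 < p → NonDivisor (c * 3) (d * 3)
  3∣a,b⇒nonDivisor c d p∤3 1≤c M<p = noCarry⇒nonDivisor (c * 3) (d * 3) p∤3
    (>⇒∤ {{>-nonZero (≤-trans (≤-trans 1≤c (m≤m*n c 3)) (m≤m+n (c * 3) (d * 3)))}} M<p)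
    λ n v 3n≡ → subst₂ _≤_
      (sym (third c n v 3n≡ (≤-<-trans (≤-trans (m≤m+n c d) c+d≤) M<p)))
      (sym (trans (cong (λ m → (m * n) % p) (sym (*-distribʳ-+ 3 c d))) (third (c + d) n v 3n≡ (≤-<-trans c+d≤ M<p))))
      (m≤m+n c d)
    where
    open ≡-Reasoning
    c+d≤ : c + d ≤ c * 3 + d * 3
    c+d≤ = +-mono-≤ (m≤m*n c 3) (m≤m*n d 3)
    expand : ∀ k v p → k * (1 + v * p) ≡ k + (k * v) * p
    expand = solve-∀
    third : ∀ k n v → 3 * n ≡ 1 + v * p → k < p → (k * 3 * n) % p ≡ k
    third k n v 3n≡ k<p = begin
      (k * 3 * n) % p          ≡⟨ cong (_% p) (*-assoc k 3 n) ⟩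
      (k * (3 * n)) % p        ≡⟨ cong (λ c → (k * c) % p) 3n≡ ⟩
      (k * (1 + v * p)) % p    ≡⟨ cong (_% p) (expand k v p) ⟩
      (k + (k * v) * p) % p    ≡⟨ digit (k * v) k<p ⟩
      k                        ∎

  -- With the same `n`, both arguments of the binomial coefficient acquire a final digit 0, which
  -- Lucas' theorem ignores.
  nonDivisor-*p : ∀ a b → NonDivisor a b → NonDivisor (a * p) (b * p)
  nonDivisor-*p a b (n , n≥1 , p∣3n-1 , p∤C) = n , n≥1 , p∣3n-1 ,
    subst₂ (λ N k → p ∤ N C k) (N≡ a b n p) (k≡ a n p) (lucas-∤ (a * n + b * n) (a * n) z≤n (s≤s z≤n) p∤C)
    where
    N≡ : ∀ a b n p → (a * n + b * n) * p ≡ a * p * n + b * p * n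
    N≡ = solve-∀
    k≡ : ∀ a n p → a * n * p ≡ a * p * n
    k≡ = solve-∀

  -- The proportion a : b = x : y says that p has a larger exponent in a than in b.
  proportion⇒nonDivisor : p ∤ 3 → ∀ {x y} → p ∣ x → p ∤ y → ∀ a b → a ≥ 1 → a * y ≡ b * x → NonDivisor a b
  proportion⇒nonDivisor p∤3 {x} {y} p∣x p∤y = <-rec (λ a → ∀ b → a ≥ 1 → a * y ≡ b * x → NonDivisor a b) step
    where
    step : ∀ a → (∀ {a′} → a′ < a → ∀ b → a′ ≥ 1 → a′ * y ≡ b * x → NonDivisor a′ b) →
           ∀ b → a ≥ 1 → a * y ≡ b * x → NonDivisor a b
    -- Descent on `a`: the proportion always forces `p ∣ a`. If also `p ∣ b`, dividing both by `p`
    -- keeps the proportion and makes `a` smaller.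
    step a rec b a≥1 ay≡bx with euclidsLemma a y pr (subst (p ∣_) (sym ay≡bx) (∣n⇒∣m*n b p∣x)) | p ∣? b
    ... | inj₂ p∣y | _ = contradiction p∣y p∤y
    ... | inj₁ p∣a | no p∤b = ∣a⇒nonDivisor a b p∤3 p∣a p∤b
    ... | inj₁ p∣a@(divides a′@(suc _) refl) | yes (divides b′ refl) =
      nonDivisor-*p a′ b′ (rec (quotient-< p∣a {{prime⇒nonTrivial pr}}) b′ (s≤s z≤n)
        (*-cancelʳ-≡ _ _ p (trans (swap a′ y p) (trans ay≡bx (sym (swap b′ x p))))))
      where
      swap : ∀ a y p → a * y * p ≡ a * p * y
      swap = solve-∀

  nonDivisor-sym : ∀ a b → NonDivisor a b → NonDivisor b a
  nonDivisor-sym a b (n , n≥1 , p∣3n-1 , p∤C) =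
    n , n≥1 , p∣3n-1 , subst (p ∤_) (+C-comm (a * n) (b * n)) p∤C

-- Choice of the prime.

∃NonDivisor : ℕ → ℕ → Set
∃NonDivisor a b = ∃₂ λ q (pr : Prime (suc q)) → NonDivisor pr a b

3∤a+b⇒∃nonDivisor : ∀ a b → 3 ∤ a + b → ∃NonDivisor a b
3∤a+b⇒∃nonDivisor a b 3∤a+b with ∃-primeDivisor (a + b + 3) (≤-trans (s≤s (s≤s z≤n)) (m≤n+m 3 (a + b)))
... | q , pr , p∣M+3 = q , pr , ∣a+b+3⇒nonDivisor pr a b p∤3 p∣M+3
  where
  p∤3 : suc q ∤ 3
  p∤3 p∣3 with prime∣3⇒≡3 pr p∣3
  -- For `p` equal to 3, `3 ∣ a + b + 3` would give `3 ∣ a + b`.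
  ... | refl = 3∤a+b (∣m+n∣m⇒∣n (subst (3 ∣_) (+-comm (a + b) 3) p∣M+3) ∣-refl)

3∣a,b⇒∃nonDivisor : ∀ a b → a ≥ 1 → 3 ∣ a → 3 ∣ b → ∃NonDivisor a b
3∣a,b⇒∃nonDivisor _ _ a≥1 (divides c@(suc _) refl) (divides d refl) with ∃-prime> (c * 3 + d * 3)
... | q , pr , M<p = q , pr ,
  -- Since `c` is positive, 3 is at most `c * 3` and hence below `p`, so `p ∤ 3`.
  3∣a,b⇒nonDivisor pr c d (>⇒∤ (≤-<-trans (≤-trans (m≤n*m 3 c) (m≤m+n (c * 3) (d * 3))) M<p)) (s≤s z≤n) M<p

-- Any prime factor of `x` serves: coprimality keeps it away from `y`, and `x ∣ a` with `3 ∤ a`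
-- keeps it different from 3.
coprimeProportion⇒∃nonDivisor : ∀ a b {x y} → a ≥ 1 → 3 ∤ a → x ∣ a → a * y ≡ b * x → 1 < x → Coprime x y → ∃NonDivisor a b
coprimeProportion⇒∃nonDivisor a b {x} {y} a≥1 3∤a x∣a ay≡bx 1<x cop with ∃-primeDivisor x 1<x
... | q , pr , p∣x = q , pr , proportion⇒nonDivisor pr p∤3 p∣x (λ p∣y → prime∤1 pr (∣-reflexive (cop (p∣x , p∣y)))) a b a≥1 ay≡bx
  where
  p∤3 : suc q ∤ 3
  p∤3 p∣3 with prime∣3⇒≡3 pr p∣3
  ... | refl = 3∤a (∣-trans p∣x x∣a)

-- Write the ratio of `a` to `b` in lowest terms as `x` to `y`. These are not both 1, since
-- otherwise `a` and `b` would both equal their gcd; the one exceeding 1 supplies the prime.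
a≢b⇒∃nonDivisor : ∀ a b → a ≥ 1 → b ≥ 1 → 3 ∤ a → 3 ∤ b → a ≢ b → ∃NonDivisor a b
a≢b⇒∃nonDivisor a b a≥1 b≥1 3∤a 3∤b a≢b = cases (1 <? x) (1 <? y)
  where
  g : ℕ
  g = gcd a b
  instance
    g≢0 : NonZero g
    g≢0 = ≢-nonZero (gcd[m,n]≢0 a b (inj₁ (m<n⇒n≢0 a≥1)))
    a≢0 : NonZero a
    a≢0 = >-nonZero a≥1
    b≢0 : NonZero b
    b≢0 = >-nonZero b≥1
  x y : ℕ
  x = a / g
  y = b / g
  xg≡a : x * g ≡ a
  xg≡a = m/n*n≡m (gcd[m,n]∣m a b)
  yg≡b : y * g ≡ b
  yg≡b = m/n*n≡m (gcd[m,n]∣n a b)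
  cross : ∀ x y g → x * g * y ≡ y * g * x
  cross = solve-∀
  ay≡bx : a * y ≡ b * x
  ay≡bx = trans (cong (_* y) (sym xg≡a)) (trans (cross x y g) (cong (_* x) yg≡b))
  cop : Coprime x y
  cop = coprime-/gcd a b
  x≥1 : x ≥ 1
  x≥1 = m≥n⇒m/n>0 (∣⇒≤ (gcd[m,n]∣m a b))
  y≥1 : y ≥ 1
  y≥1 = m≥n⇒m/n>0 (∣⇒≤ (gcd[m,n]∣n a b))
  cases : Dec (1 < x) → Dec (1 < y) → ∃NonDivisor a b
  cases (yes 1<x) _ = coprimeProportion⇒∃nonDivisor a b a≥1 3∤a (m/n∣m (gcd[m,n]∣m a b)) ay≡bx 1<x cop
  cases (no _) (yes 1<y) with coprimeProportion⇒∃nonDivisor b a b≥1 3∤b (m/n∣m (gcd[m,n]∣n a b)) (sym ay≡bx) 1<y (Coprimality.sym cop)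
  ... | q , pr , nonDivisor = q , pr , nonDivisor-sym pr b a nonDivisor
  cases (no x≯1) (no y≯1) = contradiction
    (trans (sym xg≡a) (trans (cong (_* g) (trans (≤-antisym (≮⇒≥ x≯1) x≥1) (≤-antisym y≥1 (≮⇒≥ y≯1)))) yg≡b)) a≢b

∃nonDivisor : ∀ a b → a ≥ 1 → b ≥ 1 → ∃NonDivisor a b
∃nonDivisor a b a≥1 b≥1 with 3 ∣? a + b | 3 ∣? a
... | no 3∤a+b | _ = 3∤a+b⇒∃nonDivisor a b 3∤a+b
... | yes 3∣a+b | yes 3∣a = 3∣a,b⇒∃nonDivisor a b a≥1 3∣a (∣m+n∣m⇒∣n 3∣a+b 3∣a)
... | yes 3∣a+b | no 3∤a = a≢b⇒∃nonDivisor a b a≥1 b≥1 3∤a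
  (λ 3∣b → 3∤a (∣m+n∣m⇒∣n (subst (3 ∣_) (+-comm a b) 3∣a+b) 3∣b))
  -- If `a` and `b` were equal, 3 would divide `a + a` and `3 * a`, hence their difference `a`.
  λ { refl → 3∤a (∣m+n∣m⇒∣n (subst (3 ∣_) (double a) (m∣m*n a)) 3∣a+b) }
  where
  double : ∀ a → 3 * a ≡ (a + a) + a
  double = solve-∀

theorem2p4 : ¬ (∃₂ λ (a b : ℕ) → a ≥ 1 × b ≥ 1 × ((n : ℕ) → n ≥ 1 → (3 * n ∸ 1) ∣ ((a * n + b * n) C (a * n))))
theorem2p4 (a , b , a≥1 , b≥1 , divisible) with ∃nonDivisor a b a≥1 b≥1
... | _ , _ , n , n≥1 , p∣3n-1 , p∤C = p∤C (∣-trans p∣3n-1 (divisible n n≥1))
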